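{- For every integer $n\geqslant 0$ and every $r\in\{1,2\}$, $$p(n-r)=(-1)^{r-1}\sum_{\substack{(t_r,t_{r+1},\ldots,t_n)\\ rt_r+(r+1)t_{r+1}+\cdots+nt_n=n}} \bigl(\mu(r)\, t_r+\mu(r+1)\,t_{r+1} +\cdots +\mu(n)\, t_n\bigr),$$ where the sum runs over all tuples of non-negative integers $t_r,\ldots,t_n$ with $rt_r+(r+1)t_{r+1}+\cdots+nt_n=n$.
   Context: $p(m)$ denotes the number of partitions of the integer $m$, with $p(0)=1$ and $p(m)=0$ for $m<0$. $\mu$ is the classical Möbius function on positive integers: $\mu(m)=0$ if $m$ is divisible by the square of a prime, and $\mu(m)=(-1)^s$ if $m$ is a product of $s\geqslant 0$ distinct primes. When $n<r$ the list $t_r,\ldots,t_n$ is empty, and empty sums are $0$. -}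

module Defs where

open import Data.Integer as ℤ using (ℤ; +_; -[1+_]; 0ℤ; -1ℤ)
open import Data.List.Base as List using (List; []; _∷_; length; upTo; filter; cartesianProductWith)
open import Data.List.Membership.Propositional using (_∈_)
open import Data.List.Membership.Propositional.Properties
  using (∈-filter⁺; ∈-filter⁻; ∈-upTo⁺; ∈-cartesianProductWith⁺; ∈-cartesianProductWith⁻)
import Data.List.Properties as Listₚ
open import Data.List.Relation.Unary.All as All using (All; []; _∷_)
open import Data.List.Relation.Unary.All.Properties using (¬Any⇒All¬)
open import Data.List.Relation.Unary.AllPairs using ([]; _∷_)
open import Data.List.Relation.Unary.Any using (here; there)
open import Data.List.Relation.Unary.Linked using (Linked; linked?)
open import Data.List.Relation.Unary.Unique.Propositional using (Unique)
import Data.List.Relation.Unary.Unique.Propositional.Properties as Unique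
open import Data.Nat
open import Data.List.Membership.DecPropositional _≟_ using (_∈?_)
open import Data.Nat.Divisibility using (_∣_; *-monoʳ-∣; ∣n⇒∣m*n)
open import Data.Nat.ListAction using (sum; product)
open import Data.Nat.ListAction.Properties using (∈⇒∣product)
open import Data.Nat.Primality using (Prime)
open import Data.Nat.Primality.Factorisation using (PrimeFactorisation; factorise)
open import Data.Nat.Properties
open import Data.Product using (∃; _×_; _,_; proj₁; proj₂)
open import Data.Sum using (_⊎_; inj₁; inj₂)
open import Data.Vec.Base using (Vec; []; _∷_)
import Data.Vec.Properties as Vecₚ
open import Data.Vec.Relation.Unary.All as VecAll using ([]; _∷_)
open import Relation.Binary.PropositionalEquality using (_≡_; refl; sym; subst)
open import Relation.Nullary using (yes; no)
open import Relation.Nullary.Decidable using (map′; _×-dec_)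
open import Relation.Unary using (Decidable)

-- A finite set {x | P x}, given by a list of all its elements without
-- repetitions.  Any two such lists are permutations of each other, so sizes
-- and sums do not depend on the enumeration.

record Enumeration {A : Set} (P : A → Set) : Set where
  field
    elements : List A
    unique   : Unique elements
    sound    : ∀ {x} → x ∈ elements → P x
    complete : ∀ {x} → P x → x ∈ elements

open Enumeration public

∣_∣ₑ : {A : Set} {P : A → Set} → Enumeration P → ℕ
∣ E ∣ₑ = length (elements E)

∑ : {A : Set} {P : A → Set} → Enumeration P → (A → ℤ) → ℤ
∑ E f = List.foldr ℤ._+_ 0ℤ (List.map f (elements E))

enumerateWithin : {A : Set} {P : A → Set} → Decidable P →
                  (xs : List A) → Unique xs → (∀ {x} → P x → x ∈ xs) →
                  Enumeration P
enumerateWithin P? xs xs! P⊆xs = record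
  { elements = filter P? xs
  ; unique   = Unique.filter⁺ P? xs!
  ; sound    = λ x∈ → proj₂ (∈-filter⁻ P? {xs = xs} x∈)
  ; complete = λ Px → ∈-filter⁺ P? (P⊆xs Px) Px
  }

record IsPartition (k : ℕ) (λs : List ℕ) : Set where
  constructor isPartition
  field
    positive   : All (0 <_) λs
    decreasing : Linked _≥_ λs
    total      : sum λs ≡ k

isPartition? : ∀ k → Decidable (IsPartition k)
isPartition? k λs =
  map′ (λ (a , b , c) → isPartition a b c) (λ (isPartition a b c) → a , b , c)
    (All.all? (0 <?_) λs ×-dec linked? _≥?_ λs ×-dec (sum λs ≟ k))

boundedLists : (ℓ b : ℕ) → List (List ℕ)
boundedLists zero    b = [] ∷ []
boundedLists (suc ℓ) b = [] ∷ cartesianProductWith _∷_ (upTo (suc b)) (boundedLists ℓ b)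

boundedLists-unique : ∀ ℓ b → Unique (boundedLists ℓ b)
boundedLists-unique zero    b = [] ∷ []
boundedLists-unique (suc ℓ) b =
  All.tabulate nonempty ∷
  Unique.cartesianProductWith⁺ _∷_ Listₚ.∷-injective (Unique.upTo⁺ (suc b)) (boundedLists-unique ℓ b)
  where
  nonempty : ∀ {xs} → xs ∈ cartesianProductWith _∷_ (upTo (suc b)) (boundedLists ℓ b) → [] ≡ xs → _
  nonempty xs∈ refl with ∈-cartesianProductWith⁻ _∷_ (upTo (suc b)) (boundedLists ℓ b) xs∈
  ... | _ , _ , _ , _ , ()

boundedLists-complete : ∀ ℓ b {xs} → length xs ≤ ℓ → All (_≤ b) xs → xs ∈ boundedLists ℓ b
boundedLists-complete zero    b {[]}    _         _          = here refl
boundedLists-complete (suc ℓ) b {[]}    _         _          = here refl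
boundedLists-complete (suc ℓ) b {_ ∷ _} (s≤s len) (x≤b ∷ bs) =
  there (∈-cartesianProductWith⁺ _∷_ (∈-upTo⁺ (s≤s x≤b)) (boundedLists-complete ℓ b len bs))

length≤sum : ∀ {xs} → All (0 <_) xs → length xs ≤ sum xs
length≤sum []         = z≤n
length≤sum (0<x ∷ ps) = +-mono-≤ 0<x (length≤sum ps)

all≤sum : ∀ xs → All (_≤ sum xs) xs
all≤sum []       = []
all≤sum (x ∷ xs) = m≤m+n x _ ∷ All.map (λ y≤ → ≤-trans y≤ (m≤n+m _ x)) (all≤sum xs)

partitions : ∀ k → Enumeration (IsPartition k)
partitions k = enumerateWithin (isPartition? k) (boundedLists k k) (boundedLists-unique k k)
  λ { {λs} (isPartition pos _ refl) → boundedLists-complete k k (length≤sum pos) (all≤sum λs) }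

p : ℤ → ℕ
p (+ k)    = ∣ partitions k ∣ₑ
p -[1+ _ ] = 0

data Möbius (m : ℕ) : ℤ → Set where
  squareful : ∀ {q} → Prime q → q * q ∣ m → Möbius m 0ℤ
  distinct  : ∀ {qs} → All Prime qs → Unique qs → m ≡ product qs →
              Möbius m (-1ℤ ℤ.^ length qs)

unique⊎square∣product : ∀ {qs} → All Prime qs →
                        Unique qs ⊎ ∃ λ q → Prime q × q * q ∣ product qs
unique⊎square∣product [] = inj₁ []
unique⊎square∣product {q ∷ qs} (pr ∷ prs) with q ∈? qs
... | yes q∈qs = inj₂ (q , pr , *-monoʳ-∣ q (∈⇒∣product q∈qs))
... | no  q∉qs with unique⊎square∣product prs
...   | inj₁ qs!             = inj₁ (¬Any⇒All¬ qs q∉qs ∷ qs!)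
...   | inj₂ (a , pra , a²∣) = inj₂ (a , pra , ∣n⇒∣m*n q a²∣)

möbius : ∀ m .{{_ : NonZero m}} → ∃ (Möbius m)
möbius m with factorise m
... | record { factors = qs ; isFactorisation = m≡ ; factorsPrime = prs }
    with unique⊎square∣product prs
...   | inj₁ qs!           = _ , distinct prs qs! m≡
...   | inj₂ (q , pr , q²∣) = _ , squareful pr (subst (q * q ∣_) (sym m≡) q²∣)

μ : ∀ m .{{_ : NonZero m}} → ℤ
μ m = proj₁ (möbius m)

-- For a tuple t = (t_r, t_{r+1}, …), whose entries are indexed from r on:
-- weight r t = r t_r + (r+1) t_{r+1} + ⋯   and
-- μ-sum r t  = μ(r) t_r + μ(r+1) t_{r+1} + ⋯

weight : ∀ r {l} → Vec ℕ l → ℕ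
weight r []       = 0
weight r (x ∷ xs) = r * x + weight (suc r) xs

μ-sum : ∀ r .{{_ : NonZero r}} {l} → Vec ℕ l → ℤ
μ-sum r []       = 0ℤ
μ-sum r (x ∷ xs) = μ r ℤ.* + x ℤ.+ μ-sum (suc r) xs

boundedVecs : (l b : ℕ) → List (Vec ℕ l)
boundedVecs zero    b = [] ∷ []
boundedVecs (suc l) b = cartesianProductWith _∷_ (upTo (suc b)) (boundedVecs l b)

boundedVecs-unique : ∀ l b → Unique (boundedVecs l b)
boundedVecs-unique zero    b = [] ∷ []
boundedVecs-unique (suc l) b =
  Unique.cartesianProductWith⁺ _∷_ Vecₚ.∷-injective (Unique.upTo⁺ (suc b)) (boundedVecs-unique l b)

boundedVecs-complete : ∀ {l} b {xs : Vec ℕ l} → VecAll.All (_≤ b) xs → xs ∈ boundedVecs l b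
boundedVecs-complete b []         = here refl
boundedVecs-complete b (x≤b ∷ bs) =
  ∈-cartesianProductWith⁺ _∷_ (∈-upTo⁺ (s≤s x≤b)) (boundedVecs-complete b bs)

all≤weight : ∀ r .{{_ : NonZero r}} {l} (xs : Vec ℕ l) → VecAll.All (_≤ weight r xs) xs
all≤weight r []       = []
all≤weight r (x ∷ xs) =
  ≤-trans (m≤n*m x r) (m≤m+n (r * x) _) ∷
  VecAll.map (λ y≤ → ≤-trans y≤ (m≤n+m _ (r * x))) (all≤weight (suc r) xs)

-- The tuples (t_r, …, t_n) with r t_r + ⋯ + n t_n = n.  They have n + 1 ∸ r
-- entries, hence none when n < r.

solutions : ∀ r .{{_ : NonZero r}} n →
            Enumeration (λ (t : Vec ℕ (suc n ∸ r)) → weight r t ≡ n)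
solutions r n = enumerateWithin (λ t → weight r t ≟ n) (boundedVecs _ n) (boundedVecs-unique _ n)
  λ {t} w≡n → boundedVecs-complete n (subst (λ b → VecAll.All (_≤ b) t) w≡n (all≤weight r t))

{-# OPTIONS --safe #-}
module Submission where

-- The generating function of the right-hand sum is C(x) L(x), where C counts
-- tuples by weight and L(x) = Σ μ(i) x^i / (1 - x^i): both C L and the series
-- of the sums satisfy the recurrence obtained by splitting on t_r = 0 or t_r > 0.
-- For r = 1, Σ_{d ∣ j} μ(d) = [j = 1] makes L(x) = x up to order n, while C is
-- the partition generating function.  The case r = 2 is read off from r = 1 and
-- one step of the same recurrence.

open import Defs
open import Data.Nat using (ℕ; NonZero; _∸_)
open import Data.Integer using (+_; -1ℤ; _-_; _*_; _^_)
open import Data.Sum using (_⊎_)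
open import Relation.Binary.PropositionalEquality using (_≡_)

open import Data.Fin.Base using (zero; suc; toℕ; fromℕ<)
open import Data.Fin.Properties using (toℕ-fromℕ<)
open import Data.Integer using (ℤ; 0ℤ; 1ℤ; -_; _+_)
import Data.Integer.Properties as ℤ
open import Data.Integer.Tactic.RingSolver using (solve-∀)
open import Data.List.Base using (List; []; _∷_; _++_; length; map; foldr; replicate)
open import Data.List.Membership.Propositional using (_∈_)
open import Data.List.Membership.Propositional.Properties
  using (∈-∃++; ∈-map⁺; ∈-map⁻; ∈-++⁺ˡ; ∈-++⁺ʳ; ∈-++⁻)
open import Data.List.Membership.Propositional.Properties.WithK using (unique∧set⇒bag)
open import Data.List.Properties
  using (∷-injective; ∷-injectiveˡ; length-map; length-replicate; map-cong; map-++; map-∘)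
open import Data.List.Relation.Binary.BagAndSetEquality using (∼bag⇒↭)
open import Data.List.Relation.Binary.Permutation.Propositional
  using (_↭_; ↭⇒↭ₛ; ↭-trans; ↭-reflexive)
open import Data.List.Relation.Binary.Permutation.Propositional.Properties
  using (↭-length; All-resp-↭; map⁺; shift)
import Data.List.Relation.Binary.Permutation.Setoid.Properties as ↭ₛ
open import Data.List.Relation.Unary.All as All using (All; []; _∷_)
import Data.List.Relation.Unary.All.Properties as All
open import Data.List.Relation.Unary.AllPairs using (AllPairs; []; _∷_)
import Data.List.Relation.Unary.AllPairs.Properties as AllPairs
open import Data.List.Relation.Unary.Linked.Properties using (AllPairs⇒Linked; Linked⇒AllPairs)
open import Data.List.Relation.Unary.Unique.Propositional using (Unique)
import Data.List.Relation.Unary.Unique.Propositional.Properties as Unique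
open import Data.Nat as ℕ using (zero; suc; _≤_; _<_; _≥_; z≤n; s≤s; _≤?_; _≟_)
open import Data.Nat.Coprimality using (Coprime; coprime-divisor)
open import Data.Nat.Divisibility
open import Data.Nat.Induction using (<-rec)
open import Data.Nat.ListAction using (sum; product)
open import Data.Nat.ListAction.Properties using (∈⇒∣product; product-↭; sum-++)
open import Data.Nat.Primality using (Prime; prime⇒irreducible; prime⇒nonZero)
open import Data.Nat.Primality.Factorisation
  using (factorise; factorisationUnique; factorisationHasAllPrimeFactors)
import Data.Nat.Properties as ℕ
open import Data.Product using (∃; _×_; _,_; proj₂)
open import Data.Sum using (inj₁; inj₂)
open import Data.Vec.Base as Vec using (Vec; []; _∷_; updateAt)
import Data.Vec.Properties as Vec
import Data.Vec.Relation.Unary.All as VecAll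
open import Function using (_∘_; mk⇔)
open import Relation.Binary.PropositionalEquality
  using (refl; sym; trans; cong; cong₂; subst; setoid; module ≡-Reasoning)
open import Relation.Nullary using (¬_; Dec; yes; no; contradiction)

-- The Möbius function: uniqueness of its value and its behaviour at a prime

-- A prime dividing a product of primes is one of them, so `q` can be moved to the front. Cancelling
-- it leaves `q` dividing the product of the rest, hence a second occurrence of `q`.
square∤product : ∀ {q qs} → Prime q → All Prime qs → Unique qs → ¬ q ℕ.* q ∣ product qs
square∤product {q} {qs} q-prime qs-prime qs! q²∣
  with ys , zs , qs≡ ← ∈-∃++ (factorisationHasAllPrimeFactors q-prime (∣-trans (m∣m*n q) q²∣) qs-prime)
  with qs↭ ← ↭-trans (↭-reflexive qs≡) (shift q ys zs)
  with _ ∷ rest-prime ← All-resp-↭ qs↭ qs-prime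
     | q∉rest ∷ _ ← ↭ₛ.Unique-resp-↭ (setoid ℕ) (↭⇒↭ₛ qs↭) qs!
  = All.lookup q∉rest (factorisationHasAllPrimeFactors q-prime q∣rest rest-prime) refl
  where
  q∣rest = *-cancelˡ-∣ q {{prime⇒nonZero q-prime}} (subst (q ℕ.* q ∣_) (product-↭ qs↭) q²∣)

-- `μ` takes its value from the particular witness that `möbius` computes; uniqueness lets any
-- convenient witness determine it. Two squarefree factorisations agree up to order, so their
-- lengths agree.
möbius-unique : ∀ {m v w} → Möbius m v → Möbius m w → v ≡ w
möbius-unique (squareful _ _) (squareful _ _) = refl
möbius-unique (squareful q-prime q²∣m) (distinct qs-prime qs! refl) =
  contradiction q²∣m (square∤product q-prime qs-prime qs!)
möbius-unique (distinct qs-prime qs! refl) (squareful q-prime q²∣m) =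
  contradiction q²∣m (square∤product q-prime qs-prime qs!)
möbius-unique {m} (distinct {qs} qs-prime _ m≡) (distinct {qs′} qs′-prime _ m≡′) =
  cong (-1ℤ ^_) (↭-length (factorisationUnique
    (record { factors = qs ; isFactorisation = m≡ ; factorsPrime = qs-prime })
    (record { factors = qs′ ; isFactorisation = m≡′ ; factorsPrime = qs′-prime })))

-- The extension by 0 lets sums run over ranges containing 0. It fits the squareful case, since 0 is
-- divisible by every square.
μ₀ : ℕ → ℤ
μ₀ zero      = 0ℤ
μ₀ m@(suc _) = μ m

μ₀-value : ∀ {m v} .{{_ : NonZero m}} → Möbius m v → μ₀ m ≡ v
μ₀-value {suc m} = möbius-unique (proj₂ (möbius (suc m)))

μ₀-squareful : ∀ {q m} → Prime q → q ℕ.* q ∣ m → μ₀ m ≡ 0ℤ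
μ₀-squareful {m = zero}  _       _    = refl
μ₀-squareful {m = suc _} q-prime q²∣m = μ₀-value (squareful q-prime q²∣m)

-- A new prime lengthens a list of distinct primes by one, which flips the sign; a square factor of
-- `m` persists.
μ₀-prime* : ∀ {q m} → Prime q → ¬ q ∣ m → μ₀ (q ℕ.* m) ≡ - μ₀ m
μ₀-prime* {q} {zero}  _       q∤m = contradiction (q ∣0) q∤m
μ₀-prime* {q} {suc m} q-prime q∤m = helper (proj₂ (möbius (suc m)))
  where
  instance _ = ℕ.m*n≢0 q (suc m) {{prime⇒nonZero q-prime}}
  helper : ∀ {v} → Möbius (suc m) v → μ₀ (q ℕ.* suc m) ≡ - v
  helper (squareful r-prime r²∣m) = μ₀-value (squareful r-prime (∣n⇒∣m*n q r²∣m))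
  helper (distinct qs-prime qs! m≡) =
    trans (μ₀-value (distinct (q-prime ∷ qs-prime) (All.¬Any⇒All¬ _ q∉qs ∷ qs!) (cong (q ℕ.*_) m≡)))
          (ℤ.-1*i≡-i _)
    where
    q∉qs = λ q∈qs → q∤m (subst (q ∣_) (sym m≡) (∈⇒∣product q∈qs))

-- Iverson brackets and finite sums

⟦_⟧ : {P : Set} → Dec P → ℤ
⟦ yes _ ⟧ = 1ℤ
⟦ no  _ ⟧ = 0ℤ

⟦⟧-true : {P : Set} (P? : Dec P) → P → ⟦ P? ⟧ ≡ 1ℤ
⟦⟧-true (yes _) _ = refl
⟦⟧-true (no ¬P) P = contradiction P ¬P

⟦⟧-false : {P : Set} (P? : Dec P) → ¬ P → ⟦ P? ⟧ ≡ 0ℤ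
⟦⟧-false (yes P) ¬P = contradiction P ¬P
⟦⟧-false (no _)  _  = refl

⟦⟧-cong : {P Q : Set} (P? : Dec P) (Q? : Dec Q) → (P → Q) → (Q → P) → ⟦ P? ⟧ ≡ ⟦ Q? ⟧
⟦⟧-cong (yes P) Q? to _    = sym (⟦⟧-true Q? (to P))
⟦⟧-cong (no ¬P) Q? _  from = sym (⟦⟧-false Q? (¬P ∘ from))

∑< : ℕ → (ℕ → ℤ) → ℤ
∑< zero    f = 0ℤ
∑< (suc n) f = f 0 + ∑< n (f ∘ suc)

∑<-cong : ∀ {f g} n → (∀ i → f i ≡ g i) → ∑< n f ≡ ∑< n g
∑<-cong zero    f≗g = refl
∑<-cong (suc n) f≗g = cong₂ _+_ (f≗g 0) (∑<-cong n (f≗g ∘ suc))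

∑<-zero : ∀ {f} n → (∀ i → i < n → f i ≡ 0ℤ) → ∑< n f ≡ 0ℤ
∑<-zero zero    f≗0 = refl
∑<-zero (suc n) f≗0 = cong₂ _+_ (f≗0 0 (s≤s z≤n)) (∑<-zero n (λ i i<n → f≗0 (suc i) (s≤s i<n)))

∑<-+ : ∀ f g n → ∑< n (λ i → f i + g i) ≡ ∑< n f + ∑< n g
∑<-+ f g zero    = refl
∑<-+ f g (suc n) = trans (cong (_+_ (f 0 + g 0)) (∑<-+ (f ∘ suc) (g ∘ suc) n))
                         (interchange (f 0) (g 0) _ _)
  where
  interchange : ∀ a b c d → a + b + (c + d) ≡ a + c + (b + d)
  interchange = solve-∀

∑<-neg : ∀ f n → ∑< n (λ i → - f i) ≡ - ∑< n f
∑<-neg f zero    = refl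
∑<-neg f (suc n) = trans (cong (_+_ (- f 0)) (∑<-neg (f ∘ suc) n)) (sym (ℤ.neg-distrib-+ (f 0) _))

∑<-split : ∀ f m n → ∑< (m ℕ.+ n) f ≡ ∑< m f + ∑< n (λ i → f (m ℕ.+ i))
∑<-split f zero    n = sym (ℤ.+-identityˡ _)
∑<-split f (suc m) n = trans (cong (_+_ (f 0)) (∑<-split (f ∘ suc) m n)) (sym (ℤ.+-assoc (f 0) _ _))

∑<-support : ∀ {f m} n → m ≤ n → (∀ i → m ≤ i → f i ≡ 0ℤ) → ∑< n f ≡ ∑< m f
∑<-support {f} {m} n m≤n f≗0 = begin
  ∑< n f                                      ≡⟨ cong (λ k → ∑< k f) (ℕ.m+[n∸m]≡n m≤n) ⟨
  ∑< (m ℕ.+ (n ∸ m)) f                        ≡⟨ ∑<-split f m (n ∸ m) ⟩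
  ∑< m f + ∑< (n ∸ m) (λ i → f (m ℕ.+ i))     ≡⟨ cong (_+_ (∑< m f)) (∑<-zero (n ∸ m) λ i _ → f≗0 _ (ℕ.m≤m+n m i)) ⟩
  ∑< m f + 0ℤ                                 ≡⟨ ℤ.+-identityʳ _ ⟩
  ∑< m f                                      ∎
  where open ≡-Reasoning

-- The range falls into `n` blocks of `q` consecutive indices, and only the first index of each
-- block is a multiple of `q`.
∑<-multiples : ∀ q .{{_ : NonZero q}} f n → (∀ i → ¬ q ∣ i → f i ≡ 0ℤ) →
               ∑< (n ℕ.* q) f ≡ ∑< n (λ i → f (i ℕ.* q))
∑<-multiples q         f zero    _    = refl
∑<-multiples q@(suc q′) f (suc n) f≗0 = begin
  ∑< (q ℕ.+ n ℕ.* q) f                             ≡⟨ ∑<-split f q (n ℕ.* q) ⟩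
  f 0 + ∑< q′ (f ∘ suc) + ∑< (n ℕ.* q) (λ i → f (q ℕ.+ i))
    ≡⟨ cong₂ (λ x y → f 0 + x + y)
         (∑<-zero q′ λ i i<q′ → f≗0 (suc i) (>⇒∤ (s≤s i<q′)))
         (∑<-multiples q (λ i → f (q ℕ.+ i)) n λ i q∤i → f≗0 (q ℕ.+ i) λ q∣q+i → q∤i (∣m+n∣m⇒∣n q∣q+i ∣-refl)) ⟩
  f 0 + 0ℤ + ∑< n (λ i → f (q ℕ.+ i ℕ.* q))        ≡⟨ cong (_+ ∑< n (λ i → f (q ℕ.+ i ℕ.* q))) (ℤ.+-identityʳ (f 0)) ⟩
  f 0 + ∑< n (λ i → f (q ℕ.+ i ℕ.* q))             ∎
  where open ≡-Reasoning

-- The divisor sum of the Möbius function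

prime∤⇒coprime : ∀ {q m} → Prime q → ¬ q ∣ m → Coprime m q
prime∤⇒coprime q-prime q∤m (d∣m , d∣q) with prime⇒irreducible q-prime d∣q
... | inj₁ d≡1  = d≡1
... | inj₂ refl = contradiction d∣m q∤m

prime-divisor : ∀ n → 2 ≤ n → ∃ λ q → Prime q × q ∣ n
prime-divisor n@(suc _) 2≤n with factorise n
... | record { factors = []     ; isFactorisation = n≡1 } = contradiction n≡1 (ℕ.>⇒≢ 2≤n)
... | record { factors = q ∷ qs ; isFactorisation = n≡ ; factorsPrime = q-prime ∷ _ } =
  q , q-prime , subst (q ∣_) (sym n≡) (m∣m*n (product qs))

-- The bracket selects the divisors of `j`, so the divisor sum of μ becomes a sum over an interval.
μ∣ : ℕ → ℕ → ℤ
μ∣ j d = ⟦ d ∣? j ⟧ * μ₀ d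

μ∣-beyond : ∀ j .{{_ : NonZero j}} d → j < d → μ∣ j d ≡ 0ℤ
μ∣-beyond j d j<d = trans (cong (_* μ₀ d) (⟦⟧-false (d ∣? j) (>⇒∤ j<d))) (ℤ.*-zeroˡ (μ₀ d))

-- A divisor d of m q with q ∤ d cancels against the divisor d q, and the
-- divisors d q with q ∣ d are squareful.
∑μ∣-prime* : ∀ {q} → Prime q → ∀ m .{{_ : NonZero m}} → ∑< (suc m ℕ.* q) (μ∣ (m ℕ.* q)) ≡ 0ℤ
∑μ∣-prime* {q} q-prime m = begin
  ∑< (suc m ℕ.* q) h
    ≡⟨ ∑<-cong (suc m ℕ.* q) (λ d → split (q ∣? d) (h d)) ⟩
  ∑< (suc m ℕ.* q) (λ d → prime-to d + multiple d)
    ≡⟨ ∑<-+ prime-to multiple (suc m ℕ.* q) ⟩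
  ∑< (suc m ℕ.* q) prime-to + ∑< (suc m ℕ.* q) multiple
    -- A divisor of `m * q` prime to `q` divides `m`, so the first sum stops at `m`; the second is
    -- reindexed by `d * q`. Both now run over 0, ..., `m` and can be compared term by term.
    ≡⟨ cong₂ _+_ (∑<-support {prime-to} (suc m ℕ.* q) (ℕ.m≤m*n (suc m) q) prime-to-beyond)
                 (∑<-multiples q multiple (suc m) (λ d q∤d → cong (_* h d) (⟦⟧-false (q ∣? d) q∤d))) ⟩
  ∑< (suc m) prime-to + ∑< (suc m) (λ d → multiple (d ℕ.* q))
    ≡⟨ cong (_+_ (∑< (suc m) prime-to))
         (trans (∑<-cong (suc m) cancel) (∑<-neg prime-to (suc m))) ⟩
  ∑< (suc m) prime-to - ∑< (suc m) prime-to
    ≡⟨ ℤ.+-inverseʳ (∑< (suc m) prime-to) ⟩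
  0ℤ ∎
  where
  open ≡-Reasoning
  instance _ = prime⇒nonZero q-prime
  h = μ∣ (m ℕ.* q)
  multiple prime-to : ℕ → ℤ
  multiple d = ⟦ q ∣? d ⟧ * h d
  prime-to d = (1ℤ - ⟦ q ∣? d ⟧) * h d

  split : ∀ {d} (q∣?d : Dec (q ∣ d)) x → x ≡ (1ℤ - ⟦ q∣?d ⟧) * x + ⟦ q∣?d ⟧ * x
  split q∣?d = ring ⟦ q∣?d ⟧
    where
    ring : ∀ y x → x ≡ (1ℤ - y) * x + y * x
    ring = solve-∀

  ∣m*q⇒∣m : ∀ {d} → ¬ q ∣ d → d ∣ m ℕ.* q → d ∣ m
  ∣m*q⇒∣m {d} q∤d d∣mq =
    coprime-divisor (prime∤⇒coprime q-prime q∤d) (subst (d ∣_) (ℕ.*-comm m q) d∣mq)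

  prime-to-beyond : ∀ d → suc m ≤ d → prime-to d ≡ 0ℤ
  prime-to-beyond d m<d with q ∣? d
  ... | yes _  = refl
  ... | no q∤d = trans (ℤ.*-identityˡ (h d)) (trans (cong (_* μ₀ d)
                   (⟦⟧-false (d ∣? m ℕ.* q) (>⇒∤ m<d ∘ ∣m*q⇒∣m q∤d))) (ℤ.*-zeroˡ (μ₀ d)))

  cancel : ∀ d → multiple (d ℕ.* q) ≡ - prime-to d
  cancel d with q ∣? d
  ... | yes q∣d = trans (cong (λ x → ⟦ q ∣? d ℕ.* q ⟧ * (⟦ d ℕ.* q ∣? m ℕ.* q ⟧ * x))
                              (μ₀-squareful q-prime (*-monoˡ-∣ q q∣d)))
                        (trans (cong (⟦ q ∣? d ℕ.* q ⟧ *_) (ℤ.*-zeroʳ ⟦ d ℕ.* q ∣? m ℕ.* q ⟧))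
                               (ℤ.*-zeroʳ ⟦ q ∣? d ℕ.* q ⟧))
  ... | no  q∤d = trans (cong₂ _*_ (⟦⟧-true (q ∣? d ℕ.* q) (n∣m*n d))
                          (cong₂ _*_ (⟦⟧-cong (d ℕ.* q ∣? m ℕ.* q) (d ∣? m ℕ.* q)
                                        (∣m⇒∣m*n q ∘ *-cancelʳ-∣ {d} {m} q) (*-monoˡ-∣ q ∘ ∣m*q⇒∣m q∤d))
                                     (trans (cong μ₀ (ℕ.*-comm d q)) (μ₀-prime* q-prime q∤d))))
                        (ring ⟦ d ∣? m ℕ.* q ⟧ (μ₀ d))
    where
    ring : ∀ x y → 1ℤ * (x * - y) ≡ - (1ℤ * (x * y))
    ring = solve-∀

∑μ∣ : ∀ j → 2 ≤ j → ∑< (suc j) (μ∣ j) ≡ 0ℤ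
∑μ∣ j 2≤j with prime-divisor j 2≤j
... | q , q-prime , divides zero refl = contradiction 2≤j λ ()
... | q , q-prime , divides m@(suc _) refl =
  -- No divisor exceeds `m * q`, so the range may be widened to the next multiple of `q`, which
  -- splits into whole blocks.
  trans (sym (∑<-support (suc m ℕ.* q) (ℕ.+-monoˡ-≤ (m ℕ.* q) 1≤q) (μ∣-beyond (m ℕ.* q))))
        (∑μ∣-prime* q-prime m)
  where
  instance
    _ = prime⇒nonZero q-prime
    _ = ℕ.m*n≢0 m q
  1≤q = ℕ.>-nonZero⁻¹ q

-- Power series: shifts and the Cauchy product

Sequence : Set
Sequence = ℕ → ℤ

-- Multiplication by x^k of the power series with coefficients f.
delay : ℕ → Sequence → Sequence
delay zero    f n       = f n
delay (suc k) f zero    = 0ℤ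
delay (suc k) f (suc n) = delay k f n

delay-< : ∀ {k n} f → n < k → delay k f n ≡ 0ℤ
delay-< {n = zero}  f (s≤s _)   = refl
delay-< {n = suc n} f (s≤s n<k) = delay-< f n<k

delay-≥ : ∀ k {f} n → delay k f (k ℕ.+ n) ≡ f n
delay-≥ zero    n = refl
delay-≥ (suc k) n = delay-≥ k n

delay-cong : ∀ k {f g} n → (∀ m → k ℕ.+ m ≤ n → f m ≡ g m) → delay k f n ≡ delay k g n
delay-cong zero    n       f≗g = f≗g n ℕ.≤-refl
delay-cong (suc k) zero    f≗g = refl
delay-cong (suc k) (suc n) f≗g = delay-cong k n (λ m k+m≤n → f≗g m (s≤s k+m≤n))

delay-+ : ∀ k f g n → delay k (λ m → f m + g m) n ≡ delay k f n + delay k g n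
delay-+ zero    f g n       = refl
delay-+ (suc k) f g zero    = refl
delay-+ (suc k) f g (suc n) = delay-+ k f g n

delay-* : ∀ k c f n → delay k (λ m → c * f m) n ≡ c * delay k f n
delay-* zero    c f n       = refl
delay-* (suc k) c f zero    = sym (ℤ.*-zeroʳ c)
delay-* (suc k) c f (suc n) = delay-* k c f n

-- As `k` is positive, the right-hand side at `n` uses the unknown sequence only below `n`; strong
-- induction applies.
delay-recurrence-unique : ∀ k .{{_ : NonZero k}} {f g : Sequence} (b c : Sequence) →
  (∀ n → f n ≡ b n + delay k (λ m → f m + c m) n) →
  (∀ n → g n ≡ b n + delay k (λ m → g m + c m) n) →
  ∀ n → f n ≡ g n
delay-recurrence-unique k {f} {g} b c f-rec g-rec = <-rec (λ n → f n ≡ g n) λ n f≗g → begin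
  f n                                  ≡⟨ f-rec n ⟩
  b n + delay k (λ m → f m + c m) n    ≡⟨ cong (_+_ (b n)) (delay-cong k n λ m k+m≤n →
                                            cong (_+ c m) (f≗g (ℕ.<-≤-trans (ℕ.m<n+m m (ℕ.>-nonZero⁻¹ k)) k+m≤n))) ⟩
  b n + delay k (λ m → g m + c m) n    ≡⟨ g-rec n ⟨
  g n                                  ∎
  where open ≡-Reasoning

infixl 7 _⊛_
-- The Cauchy product, with coefficients Σ a_j f_(n-j), by recursion along the first factor.
_⊛_ : Sequence → Sequence → Sequence
(a ⊛ f) zero    = a 0 * f 0
(a ⊛ f) (suc n) = a 0 * f (suc n) + ((a ∘ suc) ⊛ f) n

-- Agreement up to order `n` is enough, which matters for a series known only up to some order.
⊛-congˡ : ∀ {a b} f n → (∀ j → j ≤ n → a j ≡ b j) → (a ⊛ f) n ≡ (b ⊛ f) n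
⊛-congˡ f zero    a≗b = cong (_* f 0) (a≗b 0 z≤n)
⊛-congˡ f (suc n) a≗b =
  cong₂ _+_ (cong (_* f (suc n)) (a≗b 0 z≤n)) (⊛-congˡ f n (λ j j≤n → a≗b (suc j) (s≤s j≤n)))

⊛-congʳ : ∀ a {f g} n → (∀ j → f j ≡ g j) → (a ⊛ f) n ≡ (a ⊛ g) n
⊛-congʳ a zero    f≗g = cong (_*_ (a 0)) (f≗g 0)
⊛-congʳ a (suc n) f≗g = cong₂ _+_ (cong (_*_ (a 0)) (f≗g (suc n))) (⊛-congʳ (a ∘ suc) n f≗g)

⊛-zeroˡ : ∀ f n → ((λ _ → 0ℤ) ⊛ f) n ≡ 0ℤ
⊛-zeroˡ f zero    = ℤ.*-zeroˡ (f 0)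
⊛-zeroˡ f (suc n) = cong₂ _+_ (ℤ.*-zeroˡ (f (suc n))) (⊛-zeroˡ f n)

⊛-linearˡ : ∀ c a b f n → ((λ j → c * a j + b j) ⊛ f) n ≡ c * (a ⊛ f) n + (b ⊛ f) n
⊛-linearˡ c a b f zero    = ring c (a 0) (b 0) (f 0)
  where
  ring : ∀ c a b x → (c * a + b) * x ≡ c * (a * x) + b * x
  ring = solve-∀
⊛-linearˡ c a b f (suc n) =
  trans (cong (_+_ ((c * a 0 + b 0) * f (suc n))) (⊛-linearˡ c (a ∘ suc) (b ∘ suc) f n))
        (ring c (a 0) (b 0) (f (suc n)) _ _)
  where
  ring : ∀ c a b x y z → (c * a + b) * x + (c * y + z) ≡ c * (a * x + y) + (b * x + z)
  ring = solve-∀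

⊛-+ʳ : ∀ a f g n → (a ⊛ (λ j → f j + g j)) n ≡ (a ⊛ f) n + (a ⊛ g) n
⊛-+ʳ a f g zero    = ℤ.*-distribˡ-+ (a 0) (f 0) (g 0)
⊛-+ʳ a f g (suc n) =
  trans (cong (_+_ (a 0 * (f (suc n) + g (suc n)))) (⊛-+ʳ (a ∘ suc) f g n))
        (ring (a 0) (f (suc n)) (g (suc n)) _ _)
  where
  ring : ∀ a x y u v → a * (x + y) + (u + v) ≡ a * x + u + (a * y + v)
  ring = solve-∀

⊛-+ˡ : ∀ a b f n → ((λ j → a j + b j) ⊛ f) n ≡ (a ⊛ f) n + (b ⊛ f) n
⊛-+ˡ a b f n = begin
  ((λ j → a j + b j) ⊛ f) n        ≡⟨ ⊛-congˡ f n (λ j _ → cong (_+ b j) (sym (ℤ.*-identityˡ (a j)))) ⟩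
  ((λ j → 1ℤ * a j + b j) ⊛ f) n   ≡⟨ ⊛-linearˡ 1ℤ a b f n ⟩
  1ℤ * (a ⊛ f) n + (b ⊛ f) n       ≡⟨ cong (_+ (b ⊛ f) n) (ℤ.*-identityˡ ((a ⊛ f) n)) ⟩
  (a ⊛ f) n + (b ⊛ f) n            ∎
  where open ≡-Reasoning

⊛-delayˡ : ∀ k a f n → (delay k a ⊛ f) n ≡ delay k (a ⊛ f) n
⊛-delayˡ zero    a f n       = refl
⊛-delayˡ (suc k) a f zero    = ℤ.*-zeroˡ (f 0)
⊛-delayˡ (suc k) a f (suc n) =
  trans (cong₂ _+_ (ℤ.*-zeroˡ (f (suc n))) (⊛-delayˡ k a f n)) (ℤ.+-identityˡ (delay k (a ⊛ f) n))

-- The product recurses on its left factor, so dividing the right factor by x takes an induction of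
-- its own; the last term vanishes with `f 0`.
⊛-tailʳ : ∀ a f n → f 0 ≡ 0ℤ → (a ⊛ f) (suc n) ≡ (a ⊛ (f ∘ suc)) n
⊛-tailʳ a f zero    f0≡0 =
  trans (cong (_+_ (a 0 * f 1)) (trans (cong (_*_ (a 1)) f0≡0) (ℤ.*-zeroʳ (a 1))))
        (ℤ.+-identityʳ (a 0 * f 1))
⊛-tailʳ a f (suc n) f0≡0 = cong (_+_ (a 0 * f (suc (suc n)))) (⊛-tailʳ (a ∘ suc) f n f0≡0)

⊛-delayʳ : ∀ k a f n → (a ⊛ delay k f) n ≡ delay k (a ⊛ f) n
⊛-delayʳ zero    a f n       = refl
⊛-delayʳ (suc k) a f zero    = ℤ.*-zeroʳ (a 0)
⊛-delayʳ (suc k) a f (suc n) = trans (⊛-tailʳ a (delay (suc k) f) n refl) (⊛-delayʳ k a f n)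

δ : Sequence
δ zero    = 1ℤ
δ (suc _) = 0ℤ

⊛-identityˡ : ∀ f n → (δ ⊛ f) n ≡ f n
⊛-identityˡ f zero    = ℤ.*-identityˡ (f 0)
⊛-identityˡ f (suc n) =
  trans (cong₂ _+_ (ℤ.*-identityˡ (f (suc n))) (⊛-zeroˡ f n)) (ℤ.+-identityʳ (f (suc n)))

-- Lambert series

-- The coefficients of x^r / (1 - x^r).
multiplesOf : ℕ → Sequence
multiplesOf r zero    = 0ℤ
multiplesOf r (suc j) = ⟦ r ∣? suc j ⟧

-- This is x^r/(1 - x^r) = x^r (1 + x^r/(1 - x^r)). The `δ` supplies the constant 1, since
-- `multiplesOf r 0` is 0 although `r` divides 0.
multiplesOf-recurrence : ∀ r .{{_ : NonZero r}} n →
  multiplesOf r n ≡ delay r (λ m → δ m + multiplesOf r m) n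
multiplesOf-recurrence r@(suc _) n with r ≤? n
... | no r≰n = trans (small n (ℕ.≰⇒> r≰n)) (sym (delay-< _ (ℕ.≰⇒> r≰n)))
  where
  small : ∀ n → n < r → multiplesOf r n ≡ 0ℤ
  small zero    _   = refl
  small (suc n) n<r = ⟦⟧-false (r ∣? suc n) (>⇒∤ n<r)
... | yes r≤n = subst (λ n → multiplesOf r n ≡ delay r (λ m → δ m + multiplesOf r m) n)
                      (ℕ.m+[n∸m]≡n r≤n)
                      (trans (large (n ∸ r)) (sym (delay-≥ r (n ∸ r))))
  where
  large : ∀ m → multiplesOf r (r ℕ.+ m) ≡ δ m + multiplesOf r m
  large zero    = ⟦⟧-true (r ∣? r ℕ.+ 0) (subst (r ∣_) (sym (ℕ.+-identityʳ r)) ∣-refl)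
  large (suc m) = trans (⟦⟧-cong (r ∣? r ℕ.+ suc m) (r ∣? suc m)
                           (λ r∣ → ∣m+n∣m⇒∣n r∣ ∣-refl) (∣m∣n⇒∣m+n ∣-refl))
                        (sym (ℤ.+-identityˡ ⟦ r ∣? suc m ⟧))

-- The coefficients of μ(r) x^r/(1 - x^r) + ⋯ + μ(s) x^s/(1 - x^s), s = r + l - 1.
lambert : ℕ → ℕ → Sequence
lambert r zero    j = 0ℤ
lambert r (suc l) j = μ₀ r * multiplesOf r j + lambert (suc r) l j

lambert-zero : ∀ r l → lambert r l 0 ≡ 0ℤ
lambert-zero r zero    = refl
lambert-zero r (suc l) = cong₂ _+_ (ℤ.*-zeroʳ (μ₀ r)) (lambert-zero (suc r) l)

lambert-suc : ∀ r l j → lambert r l (suc j) ≡ ∑< l (λ i → μ∣ (suc j) (r ℕ.+ i))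
lambert-suc r zero    j = refl
lambert-suc r (suc l) j = cong₂ _+_
  (trans (ℤ.*-comm (μ₀ r) ⟦ r ∣? suc j ⟧) (cong (μ∣ (suc j)) (sym (ℕ.+-identityʳ r))))
  (trans (lambert-suc (suc r) l j) (∑<-cong l (λ i → cong (μ∣ (suc j)) (sym (ℕ.+-suc r i)))))

-- The coefficient at a positive `j` is the sum of μ(d) over the divisors d of `j`: by `j ≤ l` they
-- all lie in 1, ..., `l`. The series `delay 1 δ` is x.
lambert-1 : ∀ l j → j ≤ l → lambert 1 l j ≡ delay 1 δ j
lambert-1 l zero    _   = lambert-zero 1 l
lambert-1 l (suc j) j<l = begin
  lambert 1 l (suc j)                          ≡⟨ lambert-suc 1 l j ⟩
  -- The index 0 is added at no cost because `μ₀ 0` is 0, so that the full divisor sum from 0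
  -- appears.
  ∑< l (μ∣ (suc j) ∘ suc)                      ≡⟨ ℤ.+-identityˡ _ ⟨
  0ℤ + ∑< l (μ∣ (suc j) ∘ suc)                 ≡⟨ cong (_+ ∑< l (μ∣ (suc j) ∘ suc)) (ℤ.*-zeroʳ ⟦ 0 ∣? suc j ⟧) ⟨
  ∑< (suc l) (μ∣ (suc j))                      ≡⟨ ∑<-support (suc l) (s≤s j<l) (μ∣-beyond (suc j)) ⟩
  ∑< (suc (suc j)) (μ∣ (suc j))                ≡⟨ value j ⟩
  δ j                                          ∎
  where
  open ≡-Reasoning
  value : ∀ j → ∑< (suc (suc j)) (μ∣ (suc j)) ≡ δ j
  value zero    = cong (λ x → 0ℤ + (1ℤ * x + 0ℤ)) (μ₀-value (distinct [] [] refl))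
  value (suc j) = ∑μ∣ (suc (suc j)) (s≤s (s≤s z≤n))

-- Sums over enumerations

∑ₗ : List ℤ → ℤ
∑ₗ = foldr _+_ 0ℤ

∑ₗ-↭ : ∀ {xs ys} → xs ↭ ys → ∑ₗ xs ≡ ∑ₗ ys
∑ₗ-↭ = ↭ₛ.foldr-commMonoid (setoid ℤ) ℤ.+-0-isCommutativeMonoid ∘ ↭⇒↭ₛ

∑ₗ-++ : ∀ xs ys → ∑ₗ (xs ++ ys) ≡ ∑ₗ xs + ∑ₗ ys
∑ₗ-++ []       ys = sym (ℤ.+-identityˡ (∑ₗ ys))
∑ₗ-++ (x ∷ xs) ys = trans (cong (_+_ x) (∑ₗ-++ xs ys)) (sym (ℤ.+-assoc x (∑ₗ xs) (∑ₗ ys)))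

-- Two lists without repetitions and with the same members are equal as bags. This allows an
-- enumeration to be replaced by any explicit list of the same set.
elements-↭ : {A : Set} {P : A → Set} (E : Enumeration P) {xs : List A} → Unique xs →
             (∀ {x} → x ∈ xs → P x) → (∀ {x} → P x → x ∈ xs) → elements E ↭ xs
elements-↭ E xs! xs⊆P P⊆xs =
  ∼bag⇒↭ (unique∧set⇒bag (unique E) xs! (mk⇔ (P⊆xs ∘ sound E) (complete E ∘ xs⊆P)))

module _ {A : Set} {P : A → Set} (E : Enumeration P) where

  ∑-elements : ∀ f {xs} → elements E ↭ xs → ∑ E f ≡ ∑ₗ (map f xs)
  ∑-elements f E↭xs = ∑ₗ-↭ (map⁺ f E↭xs)

  ∑-cong : ∀ {f g : A → ℤ} → (∀ x → f x ≡ g x) → ∑ E f ≡ ∑ E g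
  ∑-cong f≗g = cong ∑ₗ (map-cong f≗g (elements E))

  ∑-linear : ∀ c f g → ∑ E (λ x → c * f x + g x) ≡ c * ∑ E f + ∑ E g
  ∑-linear c f g = go (elements E)
    where
    ring : ∀ c x y u v → c * x + y + (c * u + v) ≡ c * (x + u) + (y + v)
    ring = solve-∀
    go : ∀ xs → ∑ₗ (map (λ x → c * f x + g x) xs) ≡ c * ∑ₗ (map f xs) + ∑ₗ (map g xs)
    go []       = sym (trans (ℤ.+-identityʳ (c * 0ℤ)) (ℤ.*-zeroʳ c))
    go (x ∷ xs) = trans (cong (_+_ (c * f x + g x)) (go xs)) (ring c (f x) (g x) _ _)

  ∑-zero : ∑ E (λ _ → 0ℤ) ≡ 0ℤ
  ∑-zero = go (elements E)
    where
    go : ∀ xs → ∑ₗ (map (λ _ → 0ℤ) xs) ≡ 0ℤ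
    go []       = refl
    go (_ ∷ xs) = trans (ℤ.+-identityˡ _) (go xs)

  ∑-one : ∑ E (λ _ → 1ℤ) ≡ + ∣ E ∣ₑ
  ∑-one = go (elements E)
    where
    go : ∀ xs → ∑ₗ (map (λ _ → 1ℤ) xs) ≡ + length xs
    go []       = refl
    go (_ ∷ xs) = cong (_+_ 1ℤ) (go xs)

-- Tuples by weight, split on the first entry

-- Here the length is independent of the weight, as the recurrence lowers the weight at fixed
-- length. `solutions r n` is `tuples r (suc n ∸ r) n` by definition.
tuples : ∀ r .{{_ : NonZero r}} l n → Enumeration (λ (t : Vec ℕ l) → weight r t ≡ n)
tuples r l n = enumerateWithin (λ t → weight r t ≟ n) (boundedVecs l n) (boundedVecs-unique l n)
  λ {t} w≡n → boundedVecs-complete n (subst (λ b → VecAll.All (_≤ b) t) w≡n (all≤weight r t))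

incrementHead : ∀ {l} → Vec ℕ (suc l) → Vec ℕ (suc l)
incrementHead (x ∷ t) = suc x ∷ t

incrementHead-injective : ∀ {l} {t u : Vec ℕ (suc l)} → incrementHead t ≡ incrementHead u → t ≡ u
incrementHead-injective {t = _ ∷ _} {_ ∷ _} refl = refl

weight-0∷ : ∀ r {l} (t : Vec ℕ l) → weight r (0 ∷ t) ≡ weight (suc r) t
weight-0∷ r t = cong (ℕ._+ weight (suc r) t) (ℕ.*-zeroʳ r)

weight-incrementHead : ∀ r {l} (t : Vec ℕ (suc l)) → weight r (incrementHead t) ≡ r ℕ.+ weight r t
weight-incrementHead r (x ∷ t) =
  trans (cong (ℕ._+ weight (suc r) t) (ℕ.*-suc r x)) (ℕ.+-assoc r (r ℕ.* x) (weight (suc r) t))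

module _ (r : ℕ) .{{_ : NonZero r}} (l : ℕ) where

  tuples-< : ∀ {n} → n < r → elements (tuples r (suc l) n) ↭ map (0 ∷_) (elements (tuples (suc r) l n))
  tuples-< {n} n<r = elements-↭ (tuples r (suc l) n)
    (Unique.map⁺ Vec.∷-injectiveʳ (unique E₀))
    (λ x∈ → let t , t∈ , x≡ = ∈-map⁻ (0 ∷_) x∈ in
      trans (cong (weight r) x≡) (trans (weight-0∷ r t) (sound E₀ t∈)))
    complete′
    where
    E₀ = tuples (suc r) l n
    complete′ : ∀ {t} → weight r t ≡ n → t ∈ map (0 ∷_) (elements E₀)
    complete′ {zero ∷ t}  w≡n = ∈-map⁺ (0 ∷_) (complete E₀ (trans (sym (weight-0∷ r t)) w≡n))
    complete′ {suc x ∷ t} w≡n = contradiction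
      (subst (r ≤_) (trans (sym (weight-incrementHead r (x ∷ t))) w≡n) (ℕ.m≤m+n r _)) (ℕ.<⇒≱ n<r)

  -- The first entry is 0, or it is positive and lowering it by one lowers the weight by `r`.
  tuples-≥ : ∀ m → elements (tuples r (suc l) (r ℕ.+ m)) ↭
             map (0 ∷_) (elements (tuples (suc r) l (r ℕ.+ m))) ++
             map incrementHead (elements (tuples r (suc l) m))
  tuples-≥ m = elements-↭ (tuples r (suc l) (r ℕ.+ m))
    (Unique.++⁺ (Unique.map⁺ Vec.∷-injectiveʳ (unique E₀))
                (Unique.map⁺ incrementHead-injective (unique E₁))
                disjoint)
    sound′ complete′
    where
    E₀ = tuples (suc r) l (r ℕ.+ m)
    E₁ = tuples r (suc l) m
    disjoint : ∀ {t} → ¬ (t ∈ map (0 ∷_) (elements E₀) × t ∈ map incrementHead (elements E₁))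
    disjoint (t∈₀ , t∈₁) with ∈-map⁻ (0 ∷_) t∈₀ | ∈-map⁻ incrementHead t∈₁
    ... | _ , _ , refl | (_ ∷ _) , _ , ()
    sound′ : ∀ {t} → t ∈ map (0 ∷_) (elements E₀) ++ map incrementHead (elements E₁) →
             weight r t ≡ r ℕ.+ m
    sound′ t∈ with ∈-++⁻ (map (0 ∷_) (elements E₀)) t∈
    ... | inj₁ t∈₀ with u , u∈ , refl ← ∈-map⁻ (0 ∷_) t∈₀ = trans (weight-0∷ r u) (sound E₀ u∈)
    ... | inj₂ t∈₁ with u , u∈ , refl ← ∈-map⁻ incrementHead t∈₁ =
      trans (weight-incrementHead r u) (cong (r ℕ.+_) (sound E₁ u∈))
    complete′ : ∀ {t} → weight r t ≡ r ℕ.+ m →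
                t ∈ map (0 ∷_) (elements E₀) ++ map incrementHead (elements E₁)
    complete′ {zero ∷ t}  w≡n =
      ∈-++⁺ˡ (∈-map⁺ (0 ∷_) (complete E₀ (trans (sym (weight-0∷ r t)) w≡n)))
    complete′ {suc x ∷ t} w≡n =
      ∈-++⁺ʳ (map (0 ∷_) (elements E₀)) (∈-map⁺ incrementHead {x = x ∷ t} (complete E₁
        (ℕ.+-cancelˡ-≡ r _ _ (trans (sym (weight-incrementHead r (x ∷ t))) w≡n))))

  -- The `delay` covers both ranges of `n` at once: for `n < r` the first entry must be 0 and the
  -- delayed term vanishes.
  ∑-tuples-recurrence : ∀ f n → ∑ (tuples r (suc l) n) f ≡
    ∑ (tuples (suc r) l n) (f ∘ (0 ∷_)) + delay r (λ m → ∑ (tuples r (suc l) m) (f ∘ incrementHead)) n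
  ∑-tuples-recurrence f n with r ≤? n
  ... | no r≰n = begin
    ∑ (tuples r (suc l) n) f                    ≡⟨ ∑-elements (tuples r (suc l) n) f (tuples-< n<r) ⟩
    ∑ₗ (map f (map (0 ∷_) (elements E₀)))       ≡⟨ cong ∑ₗ (map-∘ (elements E₀)) ⟨
    ∑ E₀ (f ∘ (0 ∷_))                           ≡⟨ ℤ.+-identityʳ _ ⟨
    ∑ E₀ (f ∘ (0 ∷_)) + 0ℤ                      ≡⟨ cong (_+_ (∑ E₀ (f ∘ (0 ∷_)))) (delay-< _ n<r) ⟨
    ∑ E₀ (f ∘ (0 ∷_)) + delay r _ n             ∎
    where
    open ≡-Reasoning
    E₀ = tuples (suc r) l n
    n<r = ℕ.≰⇒> r≰n
  ... | yes r≤n with m , refl ← ℕ.m≤n⇒∃[o]m+o≡n r≤n = begin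
    ∑ (tuples r (suc l) (r ℕ.+ m)) f
      ≡⟨ ∑-elements (tuples r (suc l) (r ℕ.+ m)) f (tuples-≥ m) ⟩
    ∑ₗ (map f (map (0 ∷_) (elements E₀) ++ map incrementHead (elements E₁)))
      ≡⟨ cong ∑ₗ (map-++ f (map (0 ∷_) (elements E₀)) _) ⟩
    ∑ₗ (map f (map (0 ∷_) (elements E₀)) ++ map f (map incrementHead (elements E₁)))
      ≡⟨ ∑ₗ-++ (map f (map (0 ∷_) (elements E₀))) _ ⟩
    ∑ₗ (map f (map (0 ∷_) (elements E₀))) + ∑ₗ (map f (map incrementHead (elements E₁)))
      ≡⟨ cong₂ (λ xs ys → ∑ₗ xs + ∑ₗ ys) (map-∘ (elements E₀)) (map-∘ (elements E₁)) ⟨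
    ∑ E₀ (f ∘ (0 ∷_)) + ∑ E₁ (f ∘ incrementHead)
      ≡⟨ cong (_+_ (∑ E₀ (f ∘ (0 ∷_)))) (delay-≥ r m) ⟨
    ∑ E₀ (f ∘ (0 ∷_)) + delay r _ (r ℕ.+ m) ∎
    where
    open ≡-Reasoning
    E₀ = tuples (suc r) l (r ℕ.+ m)
    E₁ = tuples r (suc l) m

-- The generating function of the Möbius totals

-- The coefficients of the product of 1/(1 - x^i) for i = r, ..., r + l - 1.
count : ∀ r .{{_ : NonZero r}} → ℕ → Sequence
count r l n = ∑ (tuples r l n) (λ _ → 1ℤ)

μ-total : ∀ r .{{_ : NonZero r}} → ℕ → Sequence
μ-total r l n = ∑ (tuples r l n) (μ-sum r)

count-recurrence : ∀ r .{{_ : NonZero r}} l n →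
  count r (suc l) n ≡ count (suc r) l n + delay r (count r (suc l)) n
count-recurrence r l = ∑-tuples-recurrence r l (λ _ → 1ℤ)

μ≡μ₀ : ∀ r .{{_ : NonZero r}} → μ r ≡ μ₀ r
μ≡μ₀ (suc _) = refl

-- Raising t_r by one adds μ(r) to the Möbius sum of each tuple, hence the extra multiple of
-- `count`.
μ-total-recurrence : ∀ r .{{_ : NonZero r}} l n →
  μ-total r (suc l) n ≡
  μ-total (suc r) l n + delay r (λ m → μ-total r (suc l) m + μ₀ r * count r (suc l) m) n
μ-total-recurrence r l n = trans (∑-tuples-recurrence r l (μ-sum r) n) (cong₂ _+_
  (∑-cong (tuples (suc r) l n) μ-sum-0∷)
  (delay-cong r n λ m _ → begin
    ∑ (tuples r (suc l) m) (μ-sum r ∘ incrementHead)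
      ≡⟨ ∑-cong (tuples r (suc l) m) μ-sum-incrementHead ⟩
    ∑ (tuples r (suc l) m) (λ t → μ₀ r * 1ℤ + μ-sum r t)
      ≡⟨ ∑-linear (tuples r (suc l) m) (μ₀ r) (λ _ → 1ℤ) (μ-sum r) ⟩
    μ₀ r * count r (suc l) m + μ-total r (suc l) m
      ≡⟨ ℤ.+-comm (μ₀ r * count r (suc l) m) _ ⟩
    μ-total r (suc l) m + μ₀ r * count r (suc l) m ∎))
  where
  open ≡-Reasoning
  μ-sum-0∷ : ∀ {l} (t : Vec ℕ l) → μ-sum r (0 ∷ t) ≡ μ-sum (suc r) t
  μ-sum-0∷ t = trans (cong (_+ μ-sum (suc r) t) (ℤ.*-zeroʳ (μ r))) (ℤ.+-identityˡ _)
  ring : ∀ a x y → a * (1ℤ + x) + y ≡ a * 1ℤ + (a * x + y)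
  ring = solve-∀
  μ-sum-incrementHead : ∀ {l} (t : Vec ℕ (suc l)) → μ-sum r (incrementHead t) ≡ μ₀ r * 1ℤ + μ-sum r t
  μ-sum-incrementHead (x ∷ t) = trans (ring (μ r) (+ x) (μ-sum (suc r) t))
    (cong (λ a → a * 1ℤ + (μ r * + x + μ-sum (suc r) t)) (μ≡μ₀ r))

-- Induction on the number of entries. Write L = μ(r) M + L', M = x^r (1 + M) and C = C' + x^r C,
-- where L' and C' start at r + 1. Then LC = L'C' + x^r (LC + μ(r) C), which is the recurrence of
-- the totals once L'C' is known by induction.
μ-total≡lambert⊛count : ∀ r .{{_ : NonZero r}} l n → μ-total r l n ≡ (lambert r l ⊛ count r l) n
μ-total≡lambert⊛count r zero n =
  trans (trans (∑-cong (tuples r 0 n) (λ { [] → refl })) (∑-zero (tuples r 0 n)))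
        (sym (⊛-zeroˡ (count r 0) n))
μ-total≡lambert⊛count r (suc l) = delay-recurrence-unique r
  (μ-total (suc r) l) (λ m → μ₀ r * count r (suc l) m)
  (μ-total-recurrence r l) ⊛-recurrence
  where
  open ≡-Reasoning
  a b c c′ M : Sequence
  a  = lambert r (suc l)
  b  = lambert (suc r) l
  c  = count r (suc l)
  c′ = count (suc r) l
  M  = multiplesOf r

  rearrange : ∀ m x y v → m * (x + y) + v ≡ m * y + v + m * x
  rearrange = solve-∀

  M⊛c : ∀ n → (M ⊛ c) n ≡ delay r (λ m → c m + (M ⊛ c) m) n
  M⊛c n = begin
    (M ⊛ c) n                                       ≡⟨ ⊛-congˡ c n (λ j _ → multiplesOf-recurrence r j) ⟩
    (delay r (λ m → δ m + M m) ⊛ c) n               ≡⟨ ⊛-delayˡ r (λ m → δ m + M m) c n ⟩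
    delay r ((λ m → δ m + M m) ⊛ c) n               ≡⟨ delay-cong r n (λ m _ → trans (⊛-+ˡ δ M c m)
                                                         (cong (_+ (M ⊛ c) m) (⊛-identityˡ c m))) ⟩
    delay r (λ m → c m + (M ⊛ c) m) n               ∎

  b⊛c : ∀ n → (b ⊛ c) n ≡ μ-total (suc r) l n + delay r (b ⊛ c) n
  b⊛c n = begin
    (b ⊛ c) n                                       ≡⟨ ⊛-congʳ b n (count-recurrence r l) ⟩
    (b ⊛ (λ m → c′ m + delay r c m)) n              ≡⟨ ⊛-+ʳ b c′ (delay r c) n ⟩
    (b ⊛ c′) n + (b ⊛ delay r c) n                  ≡⟨ cong₂ _+_ (sym (μ-total≡lambert⊛count (suc r) l n))
                                                               (⊛-delayʳ r b c n) ⟩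
    μ-total (suc r) l n + delay r (b ⊛ c) n         ∎

  ⊛-recurrence : ∀ n → (a ⊛ c) n ≡ μ-total (suc r) l n + delay r (λ m → (a ⊛ c) m + μ₀ r * c m) n
  ⊛-recurrence n = begin
    (a ⊛ c) n
      ≡⟨ ⊛-linearˡ (μ₀ r) M b c n ⟩
    μ₀ r * (M ⊛ c) n + (b ⊛ c) n
      ≡⟨ cong₂ (λ x y → μ₀ r * x + y) (M⊛c n) (b⊛c n) ⟩
    μ₀ r * delay r (λ m → c m + (M ⊛ c) m) n + (μ-total (suc r) l n + delay r (b ⊛ c) n)
      ≡⟨ cong (_+ (μ-total (suc r) l n + delay r (b ⊛ c) n)) (delay-* r (μ₀ r) (λ m → c m + (M ⊛ c) m) n) ⟨
    delay r (λ m → μ₀ r * (c m + (M ⊛ c) m)) n + (μ-total (suc r) l n + delay r (b ⊛ c) n)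
      ≡⟨ swap (delay r (λ m → μ₀ r * (c m + (M ⊛ c) m)) n) (μ-total (suc r) l n) _ ⟩
    μ-total (suc r) l n + (delay r (λ m → μ₀ r * (c m + (M ⊛ c) m)) n + delay r (b ⊛ c) n)
      ≡⟨ cong (_+_ (μ-total (suc r) l n)) (delay-+ r (λ m → μ₀ r * (c m + (M ⊛ c) m)) (b ⊛ c) n) ⟨
    μ-total (suc r) l n + delay r (λ m → μ₀ r * (c m + (M ⊛ c) m) + (b ⊛ c) m) n
      ≡⟨ cong (_+_ (μ-total (suc r) l n)) (delay-cong r n λ m _ →
           trans (rearrange (μ₀ r) (c m) ((M ⊛ c) m) ((b ⊛ c) m))
                 (cong (_+ μ₀ r * c m) (sym (⊛-linearˡ (μ₀ r) M b c m)))) ⟩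
    μ-total (suc r) l n + delay r (λ m → (a ⊛ c) m + μ₀ r * c m) n ∎
    where
    swap : ∀ x y z → x + (y + z) ≡ y + (x + z)
    swap = solve-∀

μ-total-1 : ∀ {l n} → n ≤ l → μ-total 1 l n ≡ delay 1 (count 1 l) n
μ-total-1 {l} {n} n≤l = begin
  μ-total 1 l n                        ≡⟨ μ-total≡lambert⊛count 1 l n ⟩
  (lambert 1 l ⊛ count 1 l) n          ≡⟨ ⊛-congˡ (count 1 l) n (λ j j≤n → lambert-1 l j (ℕ.≤-trans j≤n n≤l)) ⟩
  (delay 1 δ ⊛ count 1 l) n            ≡⟨ ⊛-delayˡ 1 δ (count 1 l) n ⟩
  delay 1 (δ ⊛ count 1 l) n            ≡⟨ delay-cong 1 n (λ m _ → ⊛-identityˡ (count 1 l) m) ⟩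
  delay 1 (count 1 l) n                ∎
  where open ≡-Reasoning

-- Tuples of multiplicities as partitions

-- Larger parts come first, to match the decreasing order in `IsPartition`.
toParts : ∀ r {l} → Vec ℕ l → List ℕ
toParts r []      = []
toParts r (x ∷ t) = toParts (suc r) t ++ replicate x r

toParts-≥ : ∀ r {l} (t : Vec ℕ l) → All (r ≤_) (toParts r t)
toParts-≥ r []      = []
toParts-≥ r (x ∷ t) = All.++⁺ (All.map ℕ.<⇒≤ (toParts-≥ (suc r) t)) (All.replicate⁺ x ℕ.≤-refl)

toParts-decreasing : ∀ r {l} (t : Vec ℕ l) → AllPairs _≥_ (toParts r t)
toParts-decreasing r []      = []
toParts-decreasing r (x ∷ t) = AllPairs.++⁺ (toParts-decreasing (suc r) t) (constant x)
  (All.map (λ r<y → All.replicate⁺ x (ℕ.<⇒≤ r<y)) (toParts-≥ (suc r) t))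
  where
  constant : ∀ x → AllPairs _≥_ (replicate x r)
  constant zero    = []
  constant (suc x) = All.replicate⁺ x ℕ.≤-refl ∷ constant x

sum-toParts : ∀ r {l} (t : Vec ℕ l) → sum (toParts r t) ≡ weight r t
sum-toParts r []      = refl
sum-toParts r (x ∷ t) = begin
  sum (toParts (suc r) t ++ replicate x r)         ≡⟨ sum-++ (toParts (suc r) t) (replicate x r) ⟩
  sum (toParts (suc r) t) ℕ.+ sum (replicate x r)  ≡⟨ cong₂ ℕ._+_ (sum-toParts (suc r) t) (sum-replicate x) ⟩
  weight (suc r) t ℕ.+ r ℕ.* x                     ≡⟨ ℕ.+-comm (weight (suc r) t) (r ℕ.* x) ⟩
  r ℕ.* x ℕ.+ weight (suc r) t                     ∎
  where
  open ≡-Reasoning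
  sum-replicate : ∀ x → sum (replicate x r) ≡ r ℕ.* x
  sum-replicate zero    = sym (ℕ.*-zeroʳ r)
  sum-replicate (suc x) = trans (cong (r ℕ.+_) (sum-replicate x)) (sym (ℕ.*-suc r x))

-- The first occurrence of `r` marks the boundary, since everything before the constant block
-- exceeds `r`.
++-replicate-injective : ∀ {r xs ys} x y → All (r <_) xs → All (r <_) ys →
  xs ++ replicate x r ≡ ys ++ replicate y r → xs ≡ ys × x ≡ y
++-replicate-injective {r} {[]} {[]} x y _ _ eq =
  refl , trans (sym (length-replicate x)) (trans (cong length eq) (length-replicate y))
++-replicate-injective {xs = []}    {_ ∷ _} (suc x) y _ (r<z ∷ _) eq =
  contradiction (∷-injectiveˡ eq) (ℕ.<⇒≢ r<z)
++-replicate-injective {xs = _ ∷ _} {[]}    x (suc y) (r<z ∷ _) _ eq =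
  contradiction (sym (∷-injectiveˡ eq)) (ℕ.<⇒≢ r<z)
++-replicate-injective {xs = _ ∷ _} {_ ∷ _} x y (_ ∷ r<xs) (_ ∷ r<ys) eq
  with refl , eq′ ← ∷-injective eq
  with refl , x≡y ← ++-replicate-injective x y r<xs r<ys eq′ = refl , x≡y

toParts-injective : ∀ r {l} {t u : Vec ℕ l} → toParts r t ≡ toParts r u → t ≡ u
toParts-injective r {t = []}    {[]}    _  = refl
toParts-injective r {t = x ∷ t} {y ∷ u} eq
  with eq′ , x≡y ← ++-replicate-injective x y (toParts-≥ (suc r) t) (toParts-≥ (suc r) u) eq
  = cong₂ _∷_ x≡y (toParts-injective (suc r) eq′)

toParts-zeros : ∀ r l → toParts r (Vec.replicate l 0) ≡ []
toParts-zeros r zero    = refl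
toParts-zeros r (suc l) = cong (_++ []) (toParts-zeros (suc r) l)

-- The bound makes the added part at least as large as all others, so it lands at the front.
toParts-updateAt : ∀ r {l} (t : Vec ℕ l) i → All (_≤ r ℕ.+ toℕ i) (toParts r t) →
                   toParts r (updateAt t i suc) ≡ (r ℕ.+ toℕ i) ∷ toParts r t
toParts-updateAt r (x ∷ t) zero bounded rewrite ℕ.+-identityʳ r
  -- Parts from `t` exceed `r` but are bounded by `r`, so there are none and the new copy of `r` is
  -- first.
  with toParts (suc r) t | toParts-≥ (suc r) t | All.++⁻ˡ (toParts (suc r) t) bounded
... | []    | _       | _       = refl
... | _ ∷ _ | r<y ∷ _ | y≤r ∷ _ = contradiction y≤r (ℕ.<⇒≱ r<y)
toParts-updateAt r (x ∷ t) (suc i) bounded rewrite ℕ.+-suc r (toℕ i) =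
  cong (_++ replicate x r) (toParts-updateAt (suc r) t i (All.++⁻ˡ (toParts (suc r) t) bounded))

-- Recursion on the tail inserts the parts from the smallest up; a part `y` raises the entry at
-- position `y ∸ r`.
toParts-surjective : ∀ r l {λs} → AllPairs _≥_ λs → All (r ≤_) λs → All (_< r ℕ.+ l) λs →
                     ∃ λ (t : Vec ℕ l) → toParts r t ≡ λs
toParts-surjective r l [] _ _ = Vec.replicate l 0 , toParts-zeros r l
toParts-surjective r l {y ∷ λs} (y≥ ∷ λs↘) (r≤y ∷ r≤λs) (y< ∷ λs<)
  with t , refl ← toParts-surjective r l λs↘ r≤λs λs<
  = updateAt t i suc , trans (toParts-updateAt r t i (subst (λ z → All (_≤ z) λs) (sym r+i≡y) y≥))
                             (cong (_∷ λs) r+i≡y)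
  where
  y∸r<l : y ∸ r < l
  y∸r<l = ℕ.+-cancelˡ-< r _ _ (subst (_< r ℕ.+ l) (sym (ℕ.m+[n∸m]≡n r≤y)) y<)
  i = fromℕ< y∸r<l
  r+i≡y : r ℕ.+ toℕ i ≡ y
  r+i≡y = trans (cong (r ℕ.+_) (toℕ-fromℕ< y∸r<l)) (ℕ.m+[n∸m]≡n r≤y)

count-1≡p : ∀ {l k} → k ≤ l → count 1 l k ≡ + p (+ k)
count-1≡p {l} {k} k≤l = trans (∑-one E) (cong +_ (sym (trans
  (↭-length (elements-↭ (partitions k) (Unique.map⁺ (toParts-injective 1) (unique E)) sound′ complete′))
  (length-map (toParts 1) (elements E)))))
  where
  E = tuples 1 l k
  sound′ : ∀ {λs} → λs ∈ map (toParts 1) (elements E) → IsPartition k λs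
  sound′ λs∈ with t , t∈ , refl ← ∈-map⁻ (toParts 1) λs∈ =
    isPartition (toParts-≥ 1 t) (AllPairs⇒Linked (toParts-decreasing 1 t))
                (trans (sum-toParts 1 t) (sound E t∈))
  complete′ : ∀ {λs} → IsPartition k λs → λs ∈ map (toParts 1) (elements E)
  complete′ {λs} (isPartition pos dec total)
    -- No part exceeds the total `k`, and `k ≤ l`, so a tuple indexed by 1, ..., `l` has room for
    -- every part.
    with t , refl ← toParts-surjective 1 l (Linked⇒AllPairs (λ x≥y y≥z → ℕ.≤-trans y≥z x≥y) dec) pos
                      (All.map (λ y≤ → s≤s (ℕ.≤-trans y≤ (subst (_≤ l) (sym total) k≤l))) (all≤sum λs))
    = ∈-map⁺ (toParts 1) {x = t} (complete E (trans (sym (sum-toParts 1 t)) total))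

-- The cases r = 1 and r = 2

corollary1p2 : (n r : ℕ) .{{_ : NonZero r}} → r ≡ 1 ⊎ r ≡ 2 →
    + p (+ n - + r) ≡ -1ℤ ^ (r ∸ 1) * ∑ (solutions r n) (μ-sum r)
-- When n < r, `p` has a negative argument and at most the empty tuple contributes, with sum 0; such
-- cases hold by evaluation.
corollary1p2 zero .1 (inj₁ refl) = refl
corollary1p2 (suc m) .1 (inj₁ refl) = begin
  + p (+ m)                        ≡⟨ count-1≡p (ℕ.n≤1+n m) ⟨
  count 1 (suc m) m                ≡⟨ μ-total-1 {suc m} ℕ.≤-refl ⟨
  μ-total 1 (suc m) (suc m)        ≡⟨ ℤ.*-identityˡ _ ⟨
  1ℤ * μ-total 1 (suc m) (suc m)   ∎
  where open ≡-Reasoning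
corollary1p2 zero .2 (inj₂ refl) = refl
corollary1p2 (suc zero) .2 (inj₂ refl) = refl
corollary1p2 n@(suc (suc m)) .2 (inj₂ refl) = begin
  + p (+ m)                        ≡⟨ count-1≡p (ℕ.m≤n+m m 2) ⟨
  count 1 n m                      ≡⟨ solve-for (μ-total 2 (suc m) n) (count 1 n m) (count 1 n (suc m)) recurrence ⟩
  -1ℤ * μ-total 2 (suc m) n        ∎
  where
  open ≡-Reasoning
  -- Splitting the r = 1 sum p(n - 1) on t_1 gives the r = 2 sum, plus p(n - 2) from the r = 1 sum
  -- of weight n - 1, plus μ(1) p(n - 1). The terms p(n - 1) cancel.
  recurrence : count 1 n (suc m) ≡ μ-total 2 (suc m) n + (count 1 n m + 1ℤ * count 1 n (suc m))
  recurrence = begin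
    count 1 n (suc m)                ≡⟨ μ-total-1 {n} ℕ.≤-refl ⟨
    μ-total 1 n n                    ≡⟨ μ-total-recurrence 1 (suc m) n ⟩
    μ-total 2 (suc m) n + (μ-total 1 n (suc m) + μ₀ 1 * count 1 n (suc m))
      ≡⟨ cong₂ (λ x y → μ-total 2 (suc m) n + (x + y * count 1 n (suc m)))
           (μ-total-1 (ℕ.n≤1+n (suc m))) (μ₀-value (distinct [] [] refl)) ⟩
    μ-total 2 (suc m) n + (count 1 n m + 1ℤ * count 1 n (suc m)) ∎
  solve-for : ∀ s x y → y ≡ s + (x + 1ℤ * y) → x ≡ -1ℤ * s
  solve-for s x y eq = trans (ring₁ s x y) (trans (cong (λ z → z - s - y) (sym eq)) (ring₂ s y))
    where
    ring₁ : ∀ s x y → x ≡ s + (x + 1ℤ * y) - s - y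
    ring₁ = solve-∀
    ring₂ : ∀ s y → y - s - y ≡ -1ℤ * s
    ring₂ = solve-∀
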